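{- $R_{3}(VS) \leq 68$. That is, every $3$-coloring of $[68]$ contains two integers $a<b$ in $[68]$ of the same color with $b-a=x^2$ for some positive integer $x$.
   Context: For $n\in\mathbb{N}$, $[n]=\{1,\dots,n\}$; a $c$-coloring of $[n]$ is a function $[n]\to[c]$. For a positive integer $c$, $R_c(VS)$ (the "van der Square" number) is the least positive integer $n$ such that every $c$-coloring of $[n]$ contains two integers $a<b$ in $[n]$ of the same color with $b-a=x^2$ for some positive integer $x$. -}

module Defs where

open import Data.Nat using (ℕ; suc; _+_; _*_; _<_; _≤_)
open import Data.Fin using (Fin; toℕ)
open import Data.Product using (Σ; _×_; ∃-syntax)
open import Relation.Binary.PropositionalEquality using (_≡_)

-- [n] = {1,…,n} is represented by Fin n, where i : Fin n stands for toℕ i + 1.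
-- A c-coloring of [n] is a function Fin n → Fin c.
Coloring : ℕ → ℕ → Set
Coloring n c = Fin n → Fin c

-- The coloring χ has a monochromatic pair a < b with b - a a positive square.
-- Differences are shift-invariant, so using toℕ (0-based) instead of the
-- 1-based values is harmless.
HasMonoSquarePair : {n c : ℕ} → Coloring n c → Set
HasMonoSquarePair {n} χ =
  ∃[ a ] ∃[ b ] ∃[ x ]
    (1 ≤ x × toℕ b ≡ toℕ a + x * x × χ a ≡ χ b)

VdSquareBound : ℕ → ℕ → Set
VdSquareBound c n = (χ : Coloring n c) → HasMonoSquarePair χ

{-# OPTIONS --safe #-}

-- Suppose there is no monochromatic pair at a square distance.  Since 9 + 16 = 25,
-- both {p, p+9, p+25} and {p, p+16, p+25} are rainbow triangles, so p+9 and p+16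
-- have the same color: the coloring has period 7 away from the ends.  Seven such
-- steps give two points of the same color at distance 49 = 7².
module Submission where

open import Defs
open import Data.Nat using (ℕ; suc; _+_; _*_; s≤s; z≤n)
open import Data.Nat.Properties using (+-assoc)
open import Data.Fin using (Fin; toℕ; #_; _≟_)
open import Data.Fin.Properties using (all?)
open import Data.Product using (_,_)
open import Data.Sum using (_⊎_; inj₁; inj₂)
open import Relation.Nullary.Decidable using (from-yes; _⊎-dec_)
open import Relation.Binary.PropositionalEquality using (_≡_; refl; sym; trans; cong)

-- The root is `suc k`, so its positivity is automatic; the arguments `2`, `3`, `4`, `6` below stand
-- for roots 3, 4, 5, 7.
monoPair : ∀ {n c} {χ : Coloring n c} {a b : Fin n} (k : ℕ) →
           toℕ b ≡ toℕ a + suc k * suc k → χ a ≡ χ b → HasMonoSquarePair χ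
monoPair k b≡a+x² χa≡χb = _ , _ , suc k , s≤s z≤n , b≡a+x² , χa≡χb

-- If the first five equalities fail, `b` and `c` both avoid the two distinct colors `a` and `d`, so
-- both are the third color. Decided over all 81 cases.
twoRainbowTriangles : (a b c d : Fin 3) →
  a ≡ b ⊎ a ≡ c ⊎ a ≡ d ⊎ b ≡ d ⊎ c ≡ d ⊎ b ≡ c
twoRainbowTriangles = from-yes (all? {n = 3} λ a → all? λ b → all? λ c → all? λ d →
  (a ≟ b) ⊎-dec (a ≟ c) ⊎-dec (a ≟ d) ⊎-dec (b ≟ d) ⊎-dec (c ≟ d) ⊎-dec (b ≟ c))

-- Continuation form lets steps chain: five of the six cases end with a pair, and only the last
-- passes on an equality.
shiftBy7 : ∀ {n} (χ : Coloring n 3) (p q r s : Fin n) →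
           toℕ q ≡ toℕ p + 9 → toℕ r ≡ toℕ p + 16 → toℕ s ≡ toℕ p + 25 →
           (χ q ≡ χ r → HasMonoSquarePair χ) → HasMonoSquarePair χ
shiftBy7 χ p q r s q≡p+9 r≡p+16 s≡p+25 continue
  with twoRainbowTriangles (χ p) (χ q) (χ r) (χ s)
... | inj₁ χp≡χq                             = monoPair 2 q≡p+9 χp≡χq
... | inj₂ (inj₁ χp≡χr)                      = monoPair 3 r≡p+16 χp≡χr
... | inj₂ (inj₂ (inj₁ χp≡χs))               = monoPair 4 s≡p+25 χp≡χs
... | inj₂ (inj₂ (inj₂ (inj₁ χq≡χs)))        = monoPair 3 s≡q+16 χq≡χs
  where
  s≡q+16 : toℕ s ≡ toℕ q + 16
  s≡q+16 = trans s≡p+25 (trans (sym (+-assoc (toℕ p) 9 16)) (cong (_+ 16) (sym q≡p+9)))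
... | inj₂ (inj₂ (inj₂ (inj₂ (inj₁ χr≡χs)))) = monoPair 2 s≡r+9 χr≡χs
  where
  s≡r+9 : toℕ s ≡ toℕ r + 9
  s≡r+9 = trans s≡p+25 (trans (sym (+-assoc (toℕ p) 16 9)) (cong (_+ 9) (sym r≡p+16)))
... | inj₂ (inj₂ (inj₂ (inj₂ (inj₂ χq≡χr)))) = continue χq≡χr

theorem4p3 : VdSquareBound 3 68
theorem4p3 χ =
  -- Bases advance by 7, so each `r` is the next `q`. The last `s`, 67, is the largest element of
  -- `Fin 68`.
  shiftBy7 χ (# 0)  (# 9)  (# 16) (# 25) refl refl refl λ e₁ →
  shiftBy7 χ (# 7)  (# 16) (# 23) (# 32) refl refl refl λ e₂ →
  shiftBy7 χ (# 14) (# 23) (# 30) (# 39) refl refl refl λ e₃ →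
  shiftBy7 χ (# 21) (# 30) (# 37) (# 46) refl refl refl λ e₄ →
  shiftBy7 χ (# 28) (# 37) (# 44) (# 53) refl refl refl λ e₅ →
  shiftBy7 χ (# 35) (# 44) (# 51) (# 60) refl refl refl λ e₆ →
  shiftBy7 χ (# 42) (# 51) (# 58) (# 67) refl refl refl λ e₇ →
  monoPair {a = # 9} {b = # 58} 6 refl
    (trans e₁ (trans e₂ (trans e₃ (trans e₄ (trans e₅ (trans e₆ e₇))))))
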